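{- Assume the following (Small Derivatives Conjecture): there is an absolute constant $0<\eta<1$ such that for all but finitely many triples of coprime positive integers $(a,b,c)$ satisfying $a+b=c$ and not of the form $(1,N,q)$ with $q$ prime (up to order), there is $\psi\in\mathscr{T}(a,b)$ such that $a,b$ are $\psi$-independent and $\|\psi\|<c^\eta$. Then there is a positive integer $n_0$ such that for all $n\ge n_0$ the following holds: if $a,b,c$ are coprime positive integers, then $a^n+b^n\neq c^n$.
   Context: For a prime $p$, $v_p$ is the $p$-adic valuation. For a non-zero integer $n$, $\mathrm{supp}(n)$ is the set of primes dividing $n$. Let $\Omega$ be the free $\mathbb{Z}$-module on symbols $\xi_p$, one for each prime $p$. Define $\mathrm{d}:\mathbb{Z}\to\Omega$ by $\mathrm{d}0=0$ and $\mathrm{d}n=\sum_{p\mid n}\frac{n\,v_p(n)}{p}\,\xi_p$ for $n\ne 0$ (the coefficients are integers). For a $\mathbb{Z}$-linear map $\psi:\Omega\to\mathbb{Z}$ put $\|\psi\|=\sup_p|\psi(\xi_p)|$. Let $\mathscr{T}$ be the $\mathbb{Z}$-module of all $\mathbb{Z}$-linear $\psi:\Omega\to\mathbb{Z}$ with $\|\psi\|<\infty$. For $\psi\in\mathscr{T}$ let $\mathrm{d}^\psi=\psi\circ\mathrm{d}:\mathbb{Z}\to\mathbb{Z}$ and $\mathrm{supp}(\psi)=\{p:\psi(\xi_p)\neq0\}$. For positive integers $a,b$, $$\mathscr{T}(a,b)=\{\psi\in\mathscr{T}:\ \mathrm{supp}(\psi)\subseteq\mathrm{supp}(ab(a+b))\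 \text{and}\ \mathrm{d}^\psi(a+b)=\mathrm{d}^\psi a+\mathrm{d}^\psi b\}.$$ Integers $a,b$ are $\psi$-independent if $W^\psi(a,b):=a\,\mathrm{d}^\psi b-b\,\mathrm{d}^\psi a\neq 0$. A triple is "of the form $(1,N,q)$ up to order" if some permutation of it equals $(1,N,q)$ with $N$ a positive integer and $q$ prime. -}

module Defs where

open import Algebra.Module.Bundles using (LeftModule)
open import Algebra.Module.Construct.TensorUnit using (leftModule)
open import Algebra.Module.Morphism.Structures using (module LeftModuleMorphisms)
open import Data.Integer.Base as ℤ using (ℤ; +_; 0ℤ; 1ℤ; -1ℤ; ∣_∣; _/ℕ_)
import Data.Integer.Divisibility as ℤ
import Data.Integer.Properties as ℤ
open import Data.List.Base using (List; []; _∷_; _++_; map; foldr; filter; mapMaybe; upTo)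
open import Data.List.Extrema.Nat using (max)
open import Data.List.Membership.Propositional using (_∉_)
open import Data.List.Relation.Binary.Permutation.Propositional using (_↭_)
import Data.List.Properties as L
import Data.Maybe.Base as Maybe
open import Data.Nat.Base as ℕ using (ℕ; zero; suc; _<_; _≤_; _^_)
open import Data.Nat.Divisibility using (_∣?_)
open import Data.Nat.GCD using (gcd)
import Data.Nat.Properties as ℕ
open import Data.Nat.Primality using (Prime; prime?; prime⇒nonZero)
open import Data.Product.Base using (Σ; ∃; ∃-syntax; Σ-syntax; _×_; _,_; proj₁; proj₂)
import Data.Rational.Base as ℚ
open ℚ using (ℚ; 0ℚ; 1ℚ)
open import Data.Sum.Base using (_⊎_)
open import Function.Bundles using (_⇔_)
open import Level using (0ℓ)
open import Relation.Binary.Core using (Rel)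
open import Relation.Binary.PropositionalEquality
  using (_≡_; _≢_; refl; sym; trans; cong; cong₂; module ≡-Reasoning)
open import Relation.Nullary.Decidable using (yes; no; dec⇒maybe)
open import Relation.Nullary.Negation using (¬_)
open import Relation.Unary using (Pred; _∈_; _⊆_)

-- Elements are only ever compared through their underlying
-- natural number, since proofs of primality need not be propositionally equal.
ℙ : Set
ℙ = ∃ Prime

-- An element is a formal sum Σ mᵢ ξ_{pᵢ}, written as a list of pairs (mᵢ , pᵢ).
-- Two formal sums are identified when they have the same coefficient at
-- every symbol; this makes the ξ p a ℤ-basis.
FormalSum : Set
FormalSum = List (ℤ × ℙ)

coeff : FormalSum → ℙ → ℤ
coeff []             q = 0ℤ
coeff ((m , p) ∷ x) q with proj₁ p ℕ.≟ proj₁ q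
... | yes _ = m ℤ.+ coeff x q
... | no  _ = coeff x q

infix 4 _≈_
_≈_ : Rel FormalSum 0ℓ
x ≈ y = ∀ q → coeff x q ≡ coeff y q

infixr 7 _·_
_·_ : ℤ → FormalSum → FormalSum
k · x = map (λ (m , p) → k ℤ.* m , p) x

coeff-++ : ∀ x y q → coeff (x ++ y) q ≡ coeff x q ℤ.+ coeff y q
coeff-++ []            y q = sym (ℤ.+-identityˡ _)
coeff-++ ((m , p) ∷ x) y q with proj₁ p ℕ.≟ proj₁ q
... | yes _ = trans (cong (ℤ._+_ m) (coeff-++ x y q)) (sym (ℤ.+-assoc m _ _))
... | no  _ = coeff-++ x y q

coeff-· : ∀ k x q → coeff (k · x) q ≡ k ℤ.* coeff x q
coeff-· k []            q = sym (ℤ.*-zeroʳ k)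
coeff-· k ((m , p) ∷ x) q with proj₁ p ℕ.≟ proj₁ q
... | yes _ = trans (cong (ℤ._+_ (k ℤ.* m)) (coeff-· k x q)) (sym (ℤ.*-distribˡ-+ k m _))
... | no  _ = coeff-· k x q

private
  neg : FormalSum → FormalSum
  neg x = -1ℤ · x

  coeff-neg : ∀ x q → coeff (neg x) q ≡ ℤ.- coeff x q
  coeff-neg x q = trans (coeff-· -1ℤ x q) (ℤ.-1*i≡-i _)

  ++-cong : ∀ {x y u v} → x ≈ y → u ≈ v → (x ++ u) ≈ (y ++ v)
  ++-cong {x} {y} {u} {v} e f q = begin
    coeff (x ++ u) q          ≡⟨ coeff-++ x u q ⟩
    coeff x q ℤ.+ coeff u q   ≡⟨ cong₂ ℤ._+_ (e q) (f q) ⟩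
    coeff y q ℤ.+ coeff v q   ≡⟨ coeff-++ y v q ⟨
    coeff (y ++ v) q          ∎
    where open ≡-Reasoning

  ++-assoc : ∀ x y z → ((x ++ y) ++ z) ≈ (x ++ (y ++ z))
  ++-assoc x y z q = cong (λ w → coeff w q) (L.++-assoc x y z)

  ++-identityʳ : ∀ x → (x ++ []) ≈ x
  ++-identityʳ x q = cong (λ w → coeff w q) (L.++-identityʳ x)

  ++-comm : ∀ x y → (x ++ y) ≈ (y ++ x)
  ++-comm x y q = begin
    coeff (x ++ y) q          ≡⟨ coeff-++ x y q ⟩
    coeff x q ℤ.+ coeff y q   ≡⟨ ℤ.+-comm (coeff x q) _ ⟩
    coeff y q ℤ.+ coeff x q   ≡⟨ coeff-++ y x q ⟨
    coeff (y ++ x) q          ∎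
    where open ≡-Reasoning

  ·-cong : ∀ {j k x y} → j ≡ k → x ≈ y → (j · x) ≈ (k · y)
  ·-cong {j} {k} {x} {y} refl e q = begin
    coeff (j · x) q    ≡⟨ coeff-· j x q ⟩
    j ℤ.* coeff x q    ≡⟨ cong (j ℤ.*_) (e q) ⟩
    j ℤ.* coeff y q    ≡⟨ coeff-· j y q ⟨
    coeff (j · y) q    ∎
    where open ≡-Reasoning

  ·-distribʳ : ∀ x j k → ((j ℤ.+ k) · x) ≈ ((j · x) ++ (k · x))
  ·-distribʳ x j k q = begin
    coeff ((j ℤ.+ k) · x) q                ≡⟨ coeff-· (j ℤ.+ k) x q ⟩
    (j ℤ.+ k) ℤ.* coeff x q                ≡⟨ ℤ.*-distribʳ-+ (coeff x q) j k ⟩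
    j ℤ.* coeff x q ℤ.+ k ℤ.* coeff x q    ≡⟨ cong₂ ℤ._+_ (coeff-· j x q) (coeff-· k x q) ⟨
    coeff (j · x) q ℤ.+ coeff (k · x) q    ≡⟨ coeff-++ (j · x) (k · x) q ⟨
    coeff ((j · x) ++ (k · x)) q           ∎
    where open ≡-Reasoning

  ·-distribˡ : ∀ k x y → (k · (x ++ y)) ≈ ((k · x) ++ (k · y))
  ·-distribˡ k x y q = cong (λ w → coeff w q) (L.map-++ _ x y)

  ·-assoc : ∀ j k x → ((j ℤ.* k) · x) ≈ (j · (k · x))
  ·-assoc j k x q = begin
    coeff ((j ℤ.* k) · x) q     ≡⟨ coeff-· (j ℤ.* k) x q ⟩
    (j ℤ.* k) ℤ.* coeff x q     ≡⟨ ℤ.*-assoc j k _ ⟩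
    j ℤ.* (k ℤ.* coeff x q)     ≡⟨ cong (j ℤ.*_) (coeff-· k x q) ⟨
    j ℤ.* coeff (k · x) q       ≡⟨ coeff-· j (k · x) q ⟨
    coeff (j · (k · x)) q       ∎
    where open ≡-Reasoning

  ++-inverseʳ : ∀ x → (x ++ neg x) ≈ []
  ++-inverseʳ x q = begin
    coeff (x ++ neg x) q              ≡⟨ coeff-++ x (neg x) q ⟩
    coeff x q ℤ.+ coeff (neg x) q     ≡⟨ cong (ℤ._+_ (coeff x q)) (coeff-neg x q) ⟩
    coeff x q ℤ.+ ℤ.- coeff x q       ≡⟨ ℤ.+-inverseʳ (coeff x q) ⟩
    0ℤ                                ∎
    where open ≡-Reasoning

Ω : LeftModule ℤ.+-*-ring 0ℓ 0ℓ
Ω = record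
  { Carrierᴹ = FormalSum
  ; _≈ᴹ_     = _≈_
  ; _+ᴹ_     = _++_
  ; _*ₗ_     = _·_
  ; 0ᴹ       = []
  ; -ᴹ_      = neg
  ; isLeftModule = record
    { isLeftSemimodule = record
      { +ᴹ-isCommutativeMonoid = record
        { isMonoid = record
          { isSemigroup = record
            { isMagma = record
              { isEquivalence = record
                { refl  = λ _ → refl
                ; sym   = λ e q → sym (e q)
                ; trans = λ e f q → trans (e q) (f q)
                }
              ; ∙-cong = λ {x} {y} {u} {v} → ++-cong {x} {y} {u} {v}
              }
            ; assoc = ++-assoc
            }
          ; identity = (λ _ _ → refl) , ++-identityʳ
          }
        ; comm = ++-comm
        }
      ; isPreleftSemimodule = record
        { *ₗ-cong      = λ {j} {k} {x} {y} → ·-cong {j} {k} {x} {y}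
        ; *ₗ-zeroˡ     = λ x q → trans (coeff-· 0ℤ x q) (ℤ.*-zeroˡ (coeff x q))
        ; *ₗ-distribʳ  = ·-distribʳ
        ; *ₗ-identityˡ = λ x q → trans (coeff-· 1ℤ x q) (ℤ.*-identityˡ (coeff x q))
        ; *ₗ-assoc     = ·-assoc
        ; *ₗ-zeroʳ     = λ _ _ → refl
        ; *ₗ-distribˡ  = ·-distribˡ
        }
      }
    ; -ᴹ‿cong    = λ {x} {y} → ·-cong { -1ℤ} { -1ℤ} {x} {y} refl
    ; -ᴹ‿inverse = (λ x q → trans (++-comm (neg x) x q) (++-inverseʳ x q)) , ++-inverseʳ
    }
  }

open LeftModule Ω using (_+ᴹ_; _*ₗ_; 0ᴹ; rawLeftModule) renaming (Carrierᴹ to ∣Ω∣)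

ξ : ℙ → ∣Ω∣
ξ p = (1ℤ , p) ∷ []

-- The p-adic valuation of n.  For p prime and n ≠ 0 every k with p ^ k ∣ n
-- satisfies k ≤ n, so the maximum is over all such k.
v : ℕ → ℕ → ℕ
v p n = max 0 (filter (λ k → p ^ k ∣? n) (upTo (suc n)))

primesUpTo : ℕ → List ℙ
primesUpTo N = mapMaybe (λ p → Maybe.map (p ,_) (dec⇒maybe (prime? p))) (upTo (suc N))

-- Complete for n ≠ 0, as a divisor of n is then at most n.
primeDivisors : ℕ → List ℙ
primeDivisors n = filter (λ p → proj₁ p ∣? n) (primesUpTo n)

sumΩ : List ∣Ω∣ → ∣Ω∣
sumΩ = foldr _+ᴹ_ 0ᴹ

-- n v_p(n) / p; the division is exact.
dCoeff : ℤ → ℙ → ℤ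
dCoeff n (p , p-prime) = (n ℤ.* + v p ∣ n ∣) /ℕ p
  where instance _ = prime⇒nonZero p-prime

d : ℤ → ∣Ω∣
d (+ zero) = 0ᴹ
d n        = sumΩ (map (λ p → dCoeff n p *ₗ ξ p) (primeDivisors ∣ n ∣))

open LeftModuleMorphisms rawLeftModule
  (LeftModule.rawLeftModule (leftModule {R = ℤ.+-*-ring}))
  using (IsLeftModuleHomomorphism)

record 𝒯 : Set where
  field
    ⟦_⟧      : ∣Ω∣ → ℤ
    isLinear : IsLeftModuleHomomorphism ⟦_⟧
    bounded  : ∃[ B ] ∀ p → ∣ ⟦ ξ p ⟧ ∣ ≤ B

open 𝒯 using (⟦_⟧)

IsSup : {I : Set} → (I → ℕ) → ℕ → Set
IsSup f s = (∀ i → f i ≤ s) × (∀ t → (∀ i → f i ≤ t) → s ≤ t)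

-- ‖ ψ ‖≡ s: the supremum ‖ψ‖ is s.  It is a natural number because the
-- values are integers and bounded; it is a relation, not a function, because
-- it cannot be computed for an arbitrary ψ in 𝒯.
infix 4 ‖_‖≡_
‖_‖≡_ : 𝒯 → ℕ → Set
‖ ψ ‖≡ s = IsSup (λ p → ∣ ⟦ ψ ⟧ (ξ p) ∣) s

derivative : 𝒯 → ℤ → ℤ
derivative ψ n = ⟦ ψ ⟧ (d n)

supp : ℤ → Pred ℙ 0ℓ
supp n p = + proj₁ p ℤ.∣ n

supp𝒯 : 𝒯 → Pred ℙ 0ℓ
supp𝒯 ψ p = ⟦ ψ ⟧ (ξ p) ≢ 0ℤ

𝒯[_,_] : ℤ → ℤ → Pred 𝒯 0ℓ
𝒯[ a , b ] ψ =
  supp𝒯 ψ ⊆ supp (a ℤ.* b ℤ.* (a ℤ.+ b)) ×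
  derivative ψ (a ℤ.+ b) ≡ derivative ψ a ℤ.+ derivative ψ b

W : 𝒯 → ℤ → ℤ → ℤ
W ψ a b = a ℤ.* derivative ψ b ℤ.- b ℤ.* derivative ψ a

Independent : 𝒯 → ℤ → ℤ → Set
Independent ψ a b = W ψ a b ≢ 0ℤ

-- Dedekind cuts over ℚ.
record ℝ : Set₁ where
  field
    lower upper     : Pred ℚ 0ℓ
    lower-inhabited : ∃[ q ] q ∈ lower
    upper-inhabited : ∃[ q ] q ∈ upper
    lower-rounded   : ∀ q → q ∈ lower ⇔ (∃[ r ] q ℚ.< r × r ∈ lower)
    upper-rounded   : ∀ q → q ∈ upper ⇔ (∃[ r ] r ℚ.< q × r ∈ upper)
    disjoint        : ∀ q → ¬ (q ∈ lower × q ∈ upper)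
    located         : ∀ q r → q ℚ.< r → q ∈ lower ⊎ r ∈ upper

open ℝ using (lower; upper)

-- s < c ^ η for natural numbers s, c with c ≥ 1, and real η > 0.
-- As c ^ η is the supremum of c ^ (m / k) over rationals 0 ≤ m / k < η, this
-- says that s < c ^ (m / k), i.e. s ^ k < c ^ m, for one of them.
infix 4 _<_^ℝ_
_<_^ℝ_ : ℕ → ℕ → ℝ → Set
s < c ^ℝ η = ∃[ m ] ∃[ k-1 ] let k = suc k-1 in
  (+ m ℚ./ k) ∈ lower η × s ^ k < c ^ m

Coprime₃ : ℕ → ℕ → ℕ → Set
Coprime₃ a b c = gcd a (gcd b c) ≡ 1

OfForm[1,N,q] : ℕ → ℕ → ℕ → Set
OfForm[1,N,q] a b c =
  ∃[ N ] ∃[ q ] 0 < N × Prime q × (a ∷ b ∷ c ∷ []) ↭ (1 ∷ N ∷ q ∷ [])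

SmallDerivativesConjecture : Set₁
SmallDerivativesConjecture =
  Σ[ η ∈ ℝ ] 0ℚ ∈ lower η × 1ℚ ∈ upper η ×
  Σ[ exceptions ∈ List (ℕ × ℕ × ℕ) ]
    (∀ a b c → 0 < a → 0 < b → 0 < c →
      Coprime₃ a b c → a ℕ.+ b ≡ c → ¬ OfForm[1,N,q] a b c →
      (a , b , c) ∉ exceptions →
      Σ[ ψ ∈ 𝒯 ] ψ ∈ 𝒯[ + a , + b ] × Independent ψ (+ a) (+ b) ×
        (∃[ s ] ‖ ψ ‖≡ s × s < c ^ℝ η))

{-# OPTIONS --safe #-}
-- Suppose aⁿ + bⁿ = cⁿ and let ψ be the map the conjecture gives for the triple
-- (aⁿ, bⁿ, cⁿ), which is not exceptional once n is large and contains no prime.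
-- By the power rule the derivation identity reads cⁿ⁻¹ c′ = aⁿ⁻¹ a′ + bⁿ⁻¹ b′.
-- Eliminating aⁿ gives bⁿ⁻¹ (a b′ − b a′) = cⁿ⁻¹ (a c′ − c a′), so cⁿ⁻¹ divides
-- a b′ − b a′, which is non-zero by independence and at most ‖ψ‖ c⁵.
-- Hence cⁿ⁻⁶ ≤ ‖ψ‖ < c^{nη}, which bounds n because η < 1.
module Submission where

open import Defs
open import Algebra.Module.Bundles using (LeftModule)
open import Algebra.Module.Construct.TensorUnit using (leftModule)
open import Algebra.Module.Morphism.Structures using (module LeftModuleMorphisms)
open import Data.Integer.Base as ℤ using (ℤ; +_; 0ℤ; ∣_∣; _/ℕ_)
import Data.Integer.Properties as ℤ
import Data.Integer.Tactic.RingSolver as ℤ-Solver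
open import Data.List.Base using (List; []; _∷_; _++_; map; filter; mapMaybe; upTo; length)
open import Data.List.Extrema.Nat using (xs≤max; max≤v⁺)
open import Data.List.Membership.Propositional using (_∈_)
open import Data.List.Membership.Propositional.Properties using (∈-filter⁺; ∈-upTo⁺)
import Data.List.Properties as L
open import Data.List.Relation.Binary.Permutation.Propositional using (↭-sym)
open import Data.List.Relation.Binary.Permutation.Propositional.Properties using (∈-resp-↭)
open import Data.List.Relation.Unary.All as All using (All; []; _∷_)
open import Data.List.Relation.Unary.All.Properties as All using (all-filter; all-upTo)
open import Data.List.Relation.Unary.Any using (here; there)
open import Data.Maybe.Base as Maybe using (Maybe)
open import Data.Nat.Base
  using (ℕ; zero; suc; _+_; _*_; _∸_; _^_; _≤_; _<_; NonZero; ≢-nonZero; >-nonZero; nonTrivial⇒n>1;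
         z≤n; s≤s; z<s; s<s)
open import Data.Nat.Coprimality using (Coprime; coprime-divisor; gcd≡1⇒coprime; coprime⇒gcd≡1)
  renaming (sym to coprime-sym)
open import Data.Nat.Divisibility
open import Data.Nat.DivMod using (_/_; m*n/n≡m; m/n≤m)
open import Data.Nat.GCD using (gcd; gcd[m,n]∣m; gcd[m,n]∣n)
open import Data.Nat.Induction using (<-rec)
open import Data.Nat.ListAction using (sum)
open import Data.Nat.Primality
  using (Prime; prime?; prime⇒nonZero; prime⇒nonTrivial; prime⇒irreducible; euclidsLemma; ¬prime[1])
open import Data.Nat.Properties
import Data.Nat.Tactic.RingSolver as ℕ-Solver
open import Data.Product.Base using (∃-syntax; _×_; _,_; proj₁; proj₂)
open import Data.Rational.Base as ℚ using (ℚ; mkℚ; 1ℚ)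
import Data.Rational.Properties as ℚ
import Data.Rational.Unnormalised.Base as ℚᵘ
import Data.Rational.Unnormalised.Properties as ℚᵘ
open import Data.Sum.Base using (inj₁; inj₂)
open import Function.Base using (_∘_)
open import Function.Bundles using (module Equivalence)
open import Relation.Binary.Definitions using (tri<; tri≈; tri>)
open import Relation.Binary.PropositionalEquality
  using (_≡_; _≢_; refl; sym; trans; cong; cong₂; subst; subst₂; module ≡-Reasoning)
open import Relation.Nullary.Decidable using (yes; no; dec⇒maybe)
open import Relation.Nullary.Negation using (¬_; contradiction)
import Relation.Unary as U

open LeftModuleMorphisms (LeftModule.rawLeftModule Ω)
  (LeftModule.rawLeftModule (leftModule {R = ℤ.+-*-ring}))
  using (module IsLeftModuleHomomorphism)
open 𝒯 using (⟦_⟧)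
open ℝ using (lower; upper)

private
  variable
    e m n p u : ℕ

-- Powers, primes and coprimality

n<2^n : ∀ n → n < 2 ^ n
n<2^n zero    = z<s
n<2^n (suc n) = begin-strict
  suc n              <⟨ s<s (n<2^n n) ⟩
  suc (2 ^ n)        ≤⟨ +-monoˡ-≤ (2 ^ n) (m^n>0 2 n) ⟩
  2 ^ n + 2 ^ n      ≡⟨ cong (_+_ (2 ^ n)) (+-identityʳ _) ⟨
  2 ^ suc n          ∎
  where open ≤-Reasoning

-- Serves twice: it bounds the exponent `e` by `n` in `v-unique`, and it makes c^n outgrow every
-- exceptional triple at the end.
n<m^n : ∀ {m} → 1 < m → ∀ n → n < m ^ n
n<m^n 1<m n = <-≤-trans (n<2^n n) (^-monoˡ-≤ n 1<m)

m^n≢prime : ∀ m n → 2 ≤ n → ¬ Prime (m ^ n)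
m^n≢prime m (suc zero)      (s≤s ()) _
m^n≢prime m (suc (suc n)) _ pr with m ≟ 1
... | yes refl = ¬prime[1] (subst Prime (^-zeroˡ (suc (suc n))) pr)
... | no m≢1 with prime⇒irreducible pr (m∣m*n (m ^ suc n))
...   | inj₁ m≡1 = m≢1 m≡1
-- Cancelling `m` from `m * 1 ≡ m * m ^ suc n` leaves `1 ≡ m * m ^ n`, so again `m` is 1.
...   | inj₂ m≡m^ = m≢1 (m*n≡1⇒m≡1 m (m ^ n) (*-cancelˡ-≡ _ _ m (trans (sym m≡m^) (sym (*-identityʳ m)))))
  where
  instance
    _ : NonZero m
    _ = m*n≢0⇒m≢0 m {{prime⇒nonZero pr}}

-- A common divisor of `m` and `n * n ^ k` is coprime to `n`, hence divides `n ^ k`, and induction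
-- applies.
coprime-^ʳ : Coprime m n → ∀ k → Coprime m (n ^ k)
coprime-^ʳ c zero    (_ , d∣1) = ∣1⇒≡1 d∣1
coprime-^ʳ c (suc k) (d∣m , d∣n^) =
  coprime-^ʳ c k (d∣m , coprime-divisor (λ (i∣d , i∣n) → c (∣-trans i∣d d∣m , i∣n)) d∣n^)

coprime-^ : Coprime m n → ∀ j k → Coprime (m ^ j) (n ^ k)
coprime-^ c j k = coprime-sym (coprime-^ʳ (coprime-sym (coprime-^ʳ c k)) j)

^-monoʳ-∣ : ∀ p → m ≤ n → p ^ m ∣ p ^ n
^-monoʳ-∣ p z≤n       = 1∣ _
^-monoʳ-∣ p (s≤s m≤n) = *-monoʳ-∣ p (^-monoʳ-∣ p m≤n)

^-distribʳ-* : ∀ m n k → (m * n) ^ k ≡ m ^ k * n ^ k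
^-distribʳ-* m n zero    = refl
^-distribʳ-* m n (suc k) = begin
  m * n * (m * n) ^ k       ≡⟨ cong (m * n *_) (^-distribʳ-* m n k) ⟩
  m * n * (m ^ k * n ^ k)   ≡⟨ [m*n]*[o*p]≡[m*o]*[n*p] m n (m ^ k) (n ^ k) ⟩
  m ^ suc k * n ^ suc k     ∎
  where open ≡-Reasoning

prime∣^⇒∣ : Prime p → ∀ u n → p ∣ u ^ n → p ∣ u
prime∣^⇒∣ pr u zero    p∣ with refl ← ∣1⇒≡1 p∣ = contradiction pr ¬prime[1]
prime∣^⇒∣ pr u (suc n) p∣ with euclidsLemma u (u ^ n) pr p∣
... | inj₁ p∣u = p∣u
... | inj₂ p∣u^ = prime∣^⇒∣ pr u n p∣u^

-- Valuations

splitOff : Prime p → ∀ n → .{{NonZero n}} → ∃[ e ] ∃[ u ] n ≡ p ^ e * u × ¬ p ∣ u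
splitOff {p} pr = <-rec (λ n → .{{NonZero n}} → ∃[ e ] ∃[ u ] n ≡ p ^ e * u × ¬ p ∣ u) go
  where
  go : ∀ n → (∀ {m} → m < n → .{{NonZero m}} → ∃[ e ] ∃[ u ] m ≡ p ^ e * u × ¬ p ∣ u) →
       .{{NonZero n}} → ∃[ e ] ∃[ u ] n ≡ p ^ e * u × ¬ p ∣ u
  go n rec with p ∣? n
  ... | no  p∤n = 0 , n , sym (*-identityˡ n) , p∤n
  ... | yes p∣n =
    let instance
          _ = prime⇒nonTrivial pr
          _ = quotient≢0 p∣n
        e , u , eq , p∤u = rec (quotient-< p∣n)
    in suc e , u , (begin
      n               ≡⟨ m∣n⇒n≡m*quotient p∣n ⟩
      p * quotient p∣n ≡⟨ cong (p *_) eq ⟩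
      p * (p ^ e * u) ≡⟨ *-assoc p (p ^ e) u ⟨
      p ^ suc e * u   ∎) , p∤u
    where open ≡-Reasoning

-- Links the search in `v` to a factorisation. The exponent `e` lies in the search range since e <
-- p^e ≤ n. A larger `k` would give p · p^e ∣ p^e · u, hence p ∣ u.
v-unique : Prime p → .{{NonZero n}} → n ≡ p ^ e * u → ¬ p ∣ u → v p n ≡ e
v-unique {p} {n} {e} {u} pr n≡ p∤u = ≤-antisym
  (max≤v⁺ z≤n (All.map ≤e (all-filter (λ k → p ^ k ∣? n) (upTo (suc n)))))
  (All.lookup (xs≤max 0 _) (∈-filter⁺ (λ k → p ^ k ∣? n) (∈-upTo⁺ (s≤s e≤n)) p^e∣n))
  where
  instance _ = prime⇒nonZero pr
  instance _ = m^n≢0 p e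
  p^e∣n : p ^ e ∣ n
  p^e∣n = subst (p ^ e ∣_) (sym n≡) (m∣m*n u)
  e≤n : e ≤ n
  e≤n = ≤-trans (<⇒≤ (n<m^n (nonTrivial⇒n>1 p) e)) (∣⇒≤ p^e∣n)
    where
    instance _ = prime⇒nonTrivial pr
  ≤e : ∀ {k} → p ^ k ∣ n → k ≤ e
  ≤e {k} p^k∣n = ≮⇒≥ λ e<k → p∤u (*-cancelˡ-∣ (p ^ e)
    (subst₂ _∣_ (*-comm p (p ^ e)) n≡ (∣-trans (^-monoʳ-∣ p e<k) p^k∣n)))

v-^ : Prime p → ∀ a → .{{NonZero a}} → ∀ n → v p (a ^ n) ≡ n * v p a
v-^ {p} pr a n with e , u , a≡ , p∤u ← splitOff pr a = begin
  v p (a ^ n) ≡⟨ v-unique pr a^n≡ (p∤u ∘ prime∣^⇒∣ pr u n) ⟩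
  n * e       ≡⟨ cong (n *_) (v-unique pr a≡ p∤u) ⟨
  n * v p a   ∎
  where
  open ≡-Reasoning
  instance _ = m^n≢0 a n
  a^n≡ : a ^ n ≡ p ^ (n * e) * u ^ n
  a^n≡ = begin
    a ^ n               ≡⟨ cong (_^ n) a≡ ⟩
    (p ^ e * u) ^ n     ≡⟨ ^-distribʳ-* (p ^ e) u n ⟩
    (p ^ e) ^ n * u ^ n ≡⟨ cong (_* u ^ n) (^-*-assoc p e n) ⟩
    p ^ (e * n) * u ^ n ≡⟨ cong (λ k → p ^ k * u ^ n) (*-comm e n) ⟩
    p ^ (n * e) * u ^ n ∎

-- A crude bound read off the search range in `v`; it costs only a fixed power of c in the final
-- estimate.
v≤ : ∀ p n → v p n ≤ n
v≤ p n = max≤v⁺ z≤n (All.map ≤-pred (All.filter⁺ (λ k → p ^ k ∣? n) (all-upTo (suc n))))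

-- Derivatives

-- The function under `mapMaybe` in `primesUpTo`, named so that list lemmas can be applied to it.
asPrime : ℕ → Maybe ℙ
asPrime p = Maybe.map (p ,_) (dec⇒maybe (prime? p))

primesUpTo-suc : ∀ n → primesUpTo (suc n) ≡ primesUpTo n ++ mapMaybe asPrime (suc n ∷ [])
primesUpTo-suc n = trans
  (cong (mapMaybe asPrime) (sym (L.upTo-∷ʳ (suc n))))
  (L.mapMaybe-++ asPrime (upTo (suc n)) (suc n ∷ []))

-- A number above `n` does not divide `n`, so a longer search range adds nothing. The lists agree
-- with their primality proofs, as both take these from `prime?`.
filter-∣-primesUpTo : ∀ n → .{{NonZero n}} → ∀ k →
  filter (λ p → proj₁ p ∣? n) (primesUpTo (k + n)) ≡ primeDivisors n
filter-∣-primesUpTo n zero    = refl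
filter-∣-primesUpTo n (suc k) = begin
  filter P? (primesUpTo (suc k + n))                ≡⟨ cong (filter P?) (primesUpTo-suc (k + n)) ⟩
  filter P? (primesUpTo (k + n) ++ top)             ≡⟨ L.filter-++ P? (primesUpTo (k + n)) top ⟩
  filter P? (primesUpTo (k + n)) ++ filter P? top   ≡⟨ cong₂ _++_ (filter-∣-primesUpTo n k) filter-top ⟩
  primeDivisors n ++ []                             ≡⟨ L.++-identityʳ _ ⟩
  primeDivisors n                                   ∎
  where
  open ≡-Reasoning
  P? : (p : ℙ) → _
  P? p = proj₁ p ∣? n
  top : List ℙ
  top = mapMaybe asPrime (suc k + n ∷ [])
  filter-top : filter P? top ≡ []
  filter-top with prime? (suc k + n)
  ... | no  _ = refl
  ... | yes _ = L.filter-none P? (>⇒∤ (s≤s (m≤n+m n k)) ∷ [])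

-- Equality as lists, not just as sets, lets the sums defining `d` at a power and at its base be
-- compared term by term. The search ranges differ, so that of `a` is first extended to `a ^ suc m`.
primeDivisors-^ : ∀ a → .{{NonZero a}} → ∀ m → primeDivisors (a ^ suc m) ≡ primeDivisors a
primeDivisors-^ a m = begin
  filter (λ p → proj₁ p ∣? a ^ suc m) (primesUpTo (a ^ suc m))
    ≡⟨ L.filter-≐ _ (λ p → proj₁ p ∣? a)
         ((λ {p} → prime∣^⇒∣ (proj₂ p) a (suc m)) , ∣m⇒∣m*n (a ^ m)) (primesUpTo (a ^ suc m)) ⟩
  filter (λ p → proj₁ p ∣? a) (primesUpTo (a ^ suc m))
    ≡⟨ cong (λ N → filter (λ p → proj₁ p ∣? a) (primesUpTo N)) (m∸n+n≡m a≤a^) ⟨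
  filter (λ p → proj₁ p ∣? a) (primesUpTo (a ^ suc m ∸ a + a))
    ≡⟨ filter-∣-primesUpTo a (a ^ suc m ∸ a) ⟩
  primeDivisors a ∎
  where
  open ≡-Reasoning
  instance _ = m^n≢0 a m
  a≤a^ : a ≤ a ^ suc m
  a≤a^ = m≤m*n a (a ^ m)

length-primeDivisors : ∀ n → length (primeDivisors n) ≤ suc n
length-primeDivisors n = begin
  length (primeDivisors n) ≤⟨ L.length-filter (λ p → proj₁ p ∣? n) (primesUpTo n) ⟩
  length (primesUpTo n)    ≤⟨ L.length-mapMaybe asPrime (upTo (suc n)) ⟩
  length (upTo (suc n))    ≡⟨ L.length-upTo (suc n) ⟩
  suc n                    ∎
  where open ≤-Reasoning

dCoeff-+ : ∀ n ((p , pr) : ℙ) → let instance _ = prime⇒nonZero pr in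
           dCoeff (+ n) (p , pr) ≡ + (n * v p n / p)
dCoeff-+ n (p , pr) = cong (_/ℕ p) (sym (ℤ.pos-* n (v p n)))
  where instance _ = prime⇒nonZero pr

-- Since v_p(a^(m+1)) = (m+1) v_p(a), only the divisions by `p` need care: writing a = k p makes
-- both of them exact.
dCoeff-^ : ∀ a → .{{NonZero a}} → ∀ m (p : ℙ) → proj₁ p ∣ a →
           dCoeff (+ (a ^ suc m)) p ≡ + (suc m * a ^ m) ℤ.* dCoeff (+ a) p
dCoeff-^ a m P@(p , pr) (divides k a≡) = begin
  dCoeff (+ (a ^ suc m)) P                 ≡⟨ dCoeff-+ (a ^ suc m) P ⟩
  + (a ^ suc m * v p (a ^ suc m) / p)      ≡⟨ cong (λ j → + (j / p)) dividend ⟩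
  + (suc m * a ^ m * (k * v p a) * p / p)  ≡⟨ cong +_ (m*n/n≡m _ p) ⟩
  + (suc m * a ^ m * (k * v p a))          ≡⟨ ℤ.pos-* (suc m * a ^ m) _ ⟩
  + (suc m * a ^ m) ℤ.* + (k * v p a)      ≡⟨ cong (λ j → + (suc m * a ^ m) ℤ.* + j) quot ⟨
  + (suc m * a ^ m) ℤ.* + (a * v p a / p)  ≡⟨ cong (+ (suc m * a ^ m) ℤ.*_) (dCoeff-+ a P) ⟨
  + (suc m * a ^ m) ℤ.* dCoeff (+ a) P     ∎
  where
  open ≡-Reasoning
  instance _ = prime⇒nonZero pr
  rearrange : ∀ k p x s t → k * p * x * (s * t) ≡ s * x * (k * t) * p
  rearrange = ℕ-Solver.solve-∀
  dividend : a ^ suc m * v p (a ^ suc m) ≡ suc m * a ^ m * (k * v p a) * p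
  dividend = begin
    a * a ^ m * v p (a ^ suc m)       ≡⟨ cong₂ _*_ (cong (_* a ^ m) a≡) (v-^ pr a (suc m)) ⟩
    k * p * a ^ m * (suc m * v p a)   ≡⟨ rearrange k p (a ^ m) (suc m) (v p a) ⟩
    suc m * a ^ m * (k * v p a) * p   ∎
  swap : ∀ k p t → k * p * t ≡ k * t * p
  swap = ℕ-Solver.solve-∀
  quot : a * v p a / p ≡ k * v p a
  quot = begin
    a * v p a / p        ≡⟨ cong (λ j → j * v p a / p) a≡ ⟩
    k * p * v p a / p    ≡⟨ cong (_/ p) (swap k p (v p a)) ⟩
    k * v p a * p / p    ≡⟨ m*n/n≡m (k * v p a) p ⟩
    k * v p a            ∎

∣dCoeff∣≤ : ∀ n (p : ℙ) → ∣ dCoeff (+ n) p ∣ ≤ n * n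
∣dCoeff∣≤ n P@(p , pr) = begin
  ∣ dCoeff (+ n) P ∣ ≡⟨ cong ∣_∣ (dCoeff-+ n P) ⟩
  n * v p n / p      ≤⟨ m/n≤m (n * v p n) p ⟩
  n * v p n          ≤⟨ *-monoʳ-≤ n (v≤ p n) ⟩
  n * n              ∎
  where
  open ≤-Reasoning
  instance _ = prime⇒nonZero pr

module _ (ψ : 𝒯) where
  open IsLeftModuleHomomorphism (𝒯.isLinear ψ) using (+ᴹ-homo; *ₗ-homo; 0ᴹ-homo)

  -- The shape of `d n` with the coefficients and the list of primes set free, so that induction on
  -- the list is possible.
  combination : (ℙ → ℤ) → List ℙ → FormalSum
  combination f ps = sumΩ (map (λ p → f p · ξ p) ps)

  ⟦combination⟧-∷ : ∀ f p ps →
    ⟦ ψ ⟧ (combination f (p ∷ ps)) ≡ f p ℤ.* ⟦ ψ ⟧ (ξ p) ℤ.+ ⟦ ψ ⟧ (combination f ps)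
  ⟦combination⟧-∷ f p ps = trans
    (+ᴹ-homo (f p · ξ p) (combination f ps))
    (cong (ℤ._+ ⟦ ψ ⟧ (combination f ps)) (*ₗ-homo (f p) (ξ p)))

  -- The coefficients are compared only at primes of the list, because `dCoeff-^` is available only
  -- at divisors of `a`.
  ⟦combination⟧-scale : ∀ f g k {ps} → All (λ p → f p ≡ k ℤ.* g p) ps →
    ⟦ ψ ⟧ (combination f ps) ≡ k ℤ.* ⟦ ψ ⟧ (combination g ps)
  ⟦combination⟧-scale f g k []                  = begin
    ⟦ ψ ⟧ []          ≡⟨ 0ᴹ-homo ⟩
    0ℤ                ≡⟨ ℤ.*-zeroʳ k ⟨
    k ℤ.* 0ℤ          ≡⟨ cong (k ℤ.*_) 0ᴹ-homo ⟨
    k ℤ.* ⟦ ψ ⟧ []    ∎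
    where open ≡-Reasoning
  ⟦combination⟧-scale f g k (_∷_ {p} {ps} f≡ fs≡) = begin
    ⟦ ψ ⟧ (combination f (p ∷ ps))   ≡⟨ ⟦combination⟧-∷ f p ps ⟩
    f p ℤ.* x ℤ.+ ⟦ ψ ⟧ (combination f ps)
      ≡⟨ cong₂ (λ s t → s ℤ.* x ℤ.+ t) f≡ (⟦combination⟧-scale f g k fs≡) ⟩
    k ℤ.* g p ℤ.* x ℤ.+ k ℤ.* y      ≡⟨ factor k (g p) x y ⟩
    k ℤ.* (g p ℤ.* x ℤ.+ y)          ≡⟨ cong (k ℤ.*_) (⟦combination⟧-∷ g p ps) ⟨
    k ℤ.* ⟦ ψ ⟧ (combination g (p ∷ ps)) ∎
    where
    open ≡-Reasoning
    x = ⟦ ψ ⟧ (ξ p)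
    y = ⟦ ψ ⟧ (combination g ps)
    factor : ∀ k g x y → k ℤ.* g ℤ.* x ℤ.+ k ℤ.* y ≡ k ℤ.* (g ℤ.* x ℤ.+ y)
    factor = ℤ-Solver.solve-∀

  ∣⟦combination⟧∣≤ : ∀ f {B s} → (∀ p → ∣ f p ∣ ≤ B) → (∀ p → ∣ ⟦ ψ ⟧ (ξ p) ∣ ≤ s) →
    ∀ ps → ∣ ⟦ ψ ⟧ (combination f ps) ∣ ≤ length ps * (B * s)
  ∣⟦combination⟧∣≤ f f≤ ξ≤ [] = ≤-reflexive (cong ∣_∣ 0ᴹ-homo)
  ∣⟦combination⟧∣≤ f {B} {s} f≤ ξ≤ (p ∷ ps) = begin
    ∣ ⟦ ψ ⟧ (combination f (p ∷ ps)) ∣   ≡⟨ cong ∣_∣ (⟦combination⟧-∷ f p ps) ⟩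
    ∣ f p ℤ.* x ℤ.+ y ∣                  ≤⟨ ℤ.∣i+j∣≤∣i∣+∣j∣ (f p ℤ.* x) y ⟩
    ∣ f p ℤ.* x ∣ + ∣ y ∣                ≡⟨ cong (_+ ∣ y ∣) (ℤ.abs-* (f p) x) ⟩
    ∣ f p ∣ * ∣ x ∣ + ∣ y ∣              ≤⟨ +-mono-≤ (*-mono-≤ (f≤ p) (ξ≤ p)) (∣⟦combination⟧∣≤ f f≤ ξ≤ ps) ⟩
    B * s + length ps * (B * s)          ∎
    where
    open ≤-Reasoning
    x = ⟦ ψ ⟧ (ξ p)
    y = ⟦ ψ ⟧ (combination f ps)

  derivative-+ : ∀ n → .{{NonZero n}} →
    derivative ψ (+ n) ≡ ⟦ ψ ⟧ (combination (dCoeff (+ n)) (primeDivisors n))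
  derivative-+ (suc n) = refl

  -- The power rule: `a` and its power share their list of primes, the coefficients differ by a
  -- constant factor, and linearity of `ψ` pulls that factor out.
  derivative-^ : ∀ a → .{{NonZero a}} → ∀ m →
    derivative ψ (+ (a ^ suc m)) ≡ + (suc m * a ^ m) ℤ.* derivative ψ (+ a)
  derivative-^ a m = begin
    derivative ψ (+ (a ^ suc m))
      ≡⟨ derivative-+ (a ^ suc m) ⟩
    ⟦ ψ ⟧ (combination (dCoeff (+ (a ^ suc m))) (primeDivisors (a ^ suc m)))
      ≡⟨ cong (λ ps → ⟦ ψ ⟧ (combination (dCoeff (+ (a ^ suc m))) ps)) (primeDivisors-^ a m) ⟩
    ⟦ ψ ⟧ (combination (dCoeff (+ (a ^ suc m))) (primeDivisors a))
      ≡⟨ ⟦combination⟧-scale (dCoeff (+ (a ^ suc m))) (dCoeff (+ a)) (+ (suc m * a ^ m))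
           (All.map (λ {p} → dCoeff-^ a m p) (all-filter (λ p → proj₁ p ∣? a) (primesUpTo a))) ⟩
    + (suc m * a ^ m) ℤ.* ⟦ ψ ⟧ (combination (dCoeff (+ a)) (primeDivisors a))
      ≡⟨ cong (+ (suc m * a ^ m) ℤ.*_) (derivative-+ a) ⟨
    + (suc m * a ^ m) ℤ.* derivative ψ (+ a) ∎
    where
    open ≡-Reasoning
    instance _ = m^n≢0 a (suc m)

  -- At most `suc a` primes occur, with coefficients of size at most a² and values of `ψ` of size at
  -- most `s`.
  ∣derivative∣≤ : ∀ {s} → (∀ p → ∣ ⟦ ψ ⟧ (ξ p) ∣ ≤ s) →
    ∀ a → .{{NonZero a}} → ∣ derivative ψ (+ a) ∣ ≤ suc a * (a * a * s)
  ∣derivative∣≤ {s} ξ≤ a = begin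
    ∣ derivative ψ (+ a) ∣
      ≡⟨ cong ∣_∣ (derivative-+ a) ⟩
    ∣ ⟦ ψ ⟧ (combination (dCoeff (+ a)) (primeDivisors a)) ∣
      ≤⟨ ∣⟦combination⟧∣≤ (dCoeff (+ a)) (∣dCoeff∣≤ a) ξ≤ (primeDivisors a) ⟩
    length (primeDivisors a) * (a * a * s)
      ≤⟨ *-monoˡ-≤ (a * a * s) (length-primeDivisors a) ⟩
    suc a * (a * a * s) ∎
    where open ≤-Reasoning

-- The conjecture applied to a solution of Fermat's equation

module _ {a b c m} .{{_ : NonZero a}} .{{_ : NonZero b}} .{{_ : NonZero c}}
  (fermat : a ^ suc m + b ^ suc m ≡ c ^ suc m) (1<c : 1 < c) (b⊥c : Coprime b c)
  (ψ : 𝒯)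
  (additive : derivative ψ (+ (a ^ suc m) ℤ.+ + (b ^ suc m))
            ≡ derivative ψ (+ (a ^ suc m)) ℤ.+ derivative ψ (+ (b ^ suc m)))
  (independent : Independent ψ (+ (a ^ suc m)) (+ (b ^ suc m)))
  where

  private
    A = + a; B = + b; C = + c
    α = + (a ^ m); β = + (b ^ m); γ = + (c ^ m); N = + suc m
    x = derivative ψ A; y = derivative ψ B; z = derivative ψ C

    -- Formed from the bases `a` and `b`, not from their powers: its size does not grow with the
    -- exponent except through `ψ`.
    wronskian : ℤ
    wronskian = A ℤ.* y ℤ.- B ℤ.* x

    power-rule : ∀ k → .{{NonZero k}} →
      derivative ψ (+ (k ^ suc m)) ≡ N ℤ.* + (k ^ m) ℤ.* derivative ψ (+ k)
    power-rule k = trans (derivative-^ ψ k m) (cong (ℤ._* derivative ψ (+ k)) (ℤ.pos-* (suc m) (k ^ m)))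

    derivation-identity : γ ℤ.* z ≡ α ℤ.* x ℤ.+ β ℤ.* y
    derivation-identity = ℤ.*-cancelˡ-≡ N _ _ (begin
      N ℤ.* (γ ℤ.* z)                                ≡⟨ ℤ.*-assoc N γ z ⟨
      N ℤ.* γ ℤ.* z                                  ≡⟨ power-rule c ⟨
      derivative ψ (+ (c ^ suc m))                   ≡⟨ cong (λ k → derivative ψ (+ k)) fermat ⟨
      derivative ψ (+ (a ^ suc m + b ^ suc m))       ≡⟨ additive ⟩
      derivative ψ (+ (a ^ suc m)) ℤ.+ derivative ψ (+ (b ^ suc m))
                                                     ≡⟨ cong₂ ℤ._+_ (power-rule a) (power-rule b) ⟩
      N ℤ.* α ℤ.* x ℤ.+ N ℤ.* β ℤ.* y                ≡⟨ factor N α x β y ⟩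
      N ℤ.* (α ℤ.* x ℤ.+ β ℤ.* y)                    ∎)
      where
      open ≡-Reasoning
      factor : ∀ n a x b y → n ℤ.* a ℤ.* x ℤ.+ n ℤ.* b ℤ.* y ≡ n ℤ.* (a ℤ.* x ℤ.+ b ℤ.* y)
      factor = ℤ-Solver.solve-∀

    fermatℤ : A ℤ.* α ℤ.+ B ℤ.* β ≡ C ℤ.* γ
    fermatℤ = begin
      A ℤ.* α ℤ.+ B ℤ.* β           ≡⟨ cong₂ ℤ._+_ (ℤ.pos-* a (a ^ m)) (ℤ.pos-* b (b ^ m)) ⟨
      + (a ^ suc m + b ^ suc m)     ≡⟨ cong +_ fermat ⟩
      + (c ^ suc m)                 ≡⟨ ℤ.pos-* c (c ^ m) ⟩
      C ℤ.* γ                       ∎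
      where open ≡-Reasoning

    β*wronskian : β ℤ.* wronskian ≡ γ ℤ.* (A ℤ.* z ℤ.- C ℤ.* x)
    β*wronskian = begin
      -- The terms `A α x` on the right cancel; the derivation identity and Fermat's equation then
      -- bring out the factor `γ`.
      β ℤ.* (A ℤ.* y ℤ.- B ℤ.* x)                                  ≡⟨ expand A B x y α β ⟩
      A ℤ.* (α ℤ.* x ℤ.+ β ℤ.* y) ℤ.- (A ℤ.* α ℤ.+ B ℤ.* β) ℤ.* x
        ≡⟨ cong₂ (λ s t → A ℤ.* s ℤ.- t ℤ.* x) (sym derivation-identity) fermatℤ ⟩
      A ℤ.* (γ ℤ.* z) ℤ.- C ℤ.* γ ℤ.* x                            ≡⟨ factor A C γ x z ⟩
      γ ℤ.* (A ℤ.* z ℤ.- C ℤ.* x)                                  ∎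
      where
      open ≡-Reasoning
      expand : ∀ A B x y α β → β ℤ.* (A ℤ.* y ℤ.- B ℤ.* x) ≡
               A ℤ.* (α ℤ.* x ℤ.+ β ℤ.* y) ℤ.- (A ℤ.* α ℤ.+ B ℤ.* β) ℤ.* x
      expand = ℤ-Solver.solve-∀
      factor : ∀ A C γ x z → A ℤ.* (γ ℤ.* z) ℤ.- C ℤ.* γ ℤ.* x ≡ γ ℤ.* (A ℤ.* z ℤ.- C ℤ.* x)
      factor = ℤ-Solver.solve-∀

    -- Transfers independence from the powers to the bases: if `wronskian` vanished, so would this
    -- product.
    W≡ : W ψ (+ (a ^ suc m)) (+ (b ^ suc m)) ≡ N ℤ.* α ℤ.* β ℤ.* wronskian
    W≡ = begin
      W ψ (+ (a ^ suc m)) (+ (b ^ suc m))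
        ≡⟨ cong₂ ℤ._-_ (cong₂ ℤ._*_ (ℤ.pos-* a (a ^ m)) (power-rule b))
                       (cong₂ ℤ._*_ (ℤ.pos-* b (b ^ m)) (power-rule a)) ⟩
      A ℤ.* α ℤ.* (N ℤ.* β ℤ.* y) ℤ.- B ℤ.* β ℤ.* (N ℤ.* α ℤ.* x)
        ≡⟨ factor A α N β y B x ⟩
      N ℤ.* α ℤ.* β ℤ.* wronskian ∎
      where
      open ≡-Reasoning
      factor : ∀ A α N β y B x →
        A ℤ.* α ℤ.* (N ℤ.* β ℤ.* y) ℤ.- B ℤ.* β ℤ.* (N ℤ.* α ℤ.* x) ≡
        N ℤ.* α ℤ.* β ℤ.* (A ℤ.* y ℤ.- B ℤ.* x)
      factor = ℤ-Solver.solve-∀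

    wronskian≢0 : wronskian ≢ 0ℤ
    wronskian≢0 w≡0 = independent
      (trans W≡ (trans (cong (N ℤ.* α ℤ.* β ℤ.*_) w≡0) (ℤ.*-zeroʳ (N ℤ.* α ℤ.* β))))

    -- By `β*wronskian`, c^m divides b^m times the Wronskian, and c^m is coprime to b^m.
    c^m∣wronskian : c ^ m ∣ ∣ wronskian ∣
    c^m∣wronskian = coprime-divisor (coprime-sym (coprime-^ b⊥c m m)) (divides ∣ A ℤ.* z ℤ.- C ℤ.* x ∣ (begin
      b ^ m * ∣ wronskian ∣                     ≡⟨ ℤ.abs-* β wronskian ⟨
      ∣ β ℤ.* wronskian ∣                       ≡⟨ cong ∣_∣ β*wronskian ⟩
      ∣ γ ℤ.* (A ℤ.* z ℤ.- C ℤ.* x) ∣           ≡⟨ ℤ.abs-* γ (A ℤ.* z ℤ.- C ℤ.* x) ⟩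
      c ^ m * ∣ A ℤ.* z ℤ.- C ℤ.* x ∣           ≡⟨ *-comm (c ^ m) _ ⟩
      ∣ A ℤ.* z ℤ.- C ℤ.* x ∣ * c ^ m           ∎))
      where open ≡-Reasoning

    -- Otherwise c^(m+1) ≤ a^(m+1) < a^(m+1) + b^(m+1).
    a<c : a < c
    a<c = ≰⇒> λ c≤a → <⇒≱ (m<m+n (a ^ suc m) (m^n>0 b (suc m)))
      (≤-trans (≤-reflexive fermat) (^-monoˡ-≤ (suc m) c≤a))

    b<c : b < c
    b<c = ≰⇒> λ c≤b → <⇒≱ (m<n+m (b ^ suc m) (m^n>0 a (suc m)))
      (≤-trans (≤-reflexive fermat) (^-monoˡ-≤ (suc m) c≤b))

  c^m≤c^5*‖ψ‖ : ∀ {s} → (∀ p → ∣ ⟦ ψ ⟧ (ξ p) ∣ ≤ s) → c ^ m ≤ c ^ 5 * s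
  c^m≤c^5*‖ψ‖ {s} ξ≤ = begin
    c ^ m                                        ≤⟨ ∣⇒≤ c^m∣wronskian ⟩
    ∣ wronskian ∣                                ≤⟨ ℤ.∣i-j∣≤∣i∣+∣j∣ (A ℤ.* y) (B ℤ.* x) ⟩
    ∣ A ℤ.* y ∣ + ∣ B ℤ.* x ∣                    ≡⟨ cong₂ _+_ (ℤ.abs-* A y) (ℤ.abs-* B x) ⟩
    a * ∣ y ∣ + b * ∣ x ∣
      ≤⟨ +-mono-≤ (*-mono-≤ (<⇒≤ a<c) (∣derivative∣≤c b<c)) (*-mono-≤ (<⇒≤ b<c) (∣derivative∣≤c a<c)) ⟩
    c * (c * (c * c * s)) + c * (c * (c * c * s)) ≡⟨ double c s ⟩
    -- The factor 2 is absorbed by c ≥ 2, which turns 2 c⁴ into c⁵.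
    2 * (c * c * c * c * s)                      ≤⟨ *-monoˡ-≤ (c * c * c * c * s) 1<c ⟩
    c * (c * c * c * c * s)                      ≡⟨ collect c s ⟩
    c ^ 5 * s                                    ∎
    where
    open ≤-Reasoning
    instance
      _ : NonZero ∣ wronskian ∣
      _ = ≢-nonZero (wronskian≢0 ∘ ℤ.∣i∣≡0⇒i≡0)
    ∣derivative∣≤c : ∀ {k} → .{{NonZero k}} → k < c → ∣ derivative ψ (+ k) ∣ ≤ c * (c * c * s)
    -- By definition `k < c` is `suc k ≤ c`, so the factor `suc k` costs no more than c.
    ∣derivative∣≤c {k} k<c = ≤-trans (∣derivative∣≤ ψ ξ≤ k)
      (*-mono-≤ k<c (*-monoˡ-≤ s (*-mono-≤ (<⇒≤ k<c) (<⇒≤ k<c))))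
    double : ∀ c s → c * (c * (c * c * s)) + c * (c * (c * c * s)) ≡ 2 * (c * c * c * c * s)
    double = ℕ-Solver.solve-∀
    collect : ∀ c s → c * (c * c * c * c * s) ≡ c * (c * (c * (c * (c * 1)))) * s
    collect = ℕ-Solver.solve-∀

-- Exponents bounded away from 1

-- The upper cut is open, so it contains a rational r < 1. With denominator δ + 1, r is at most
-- δ/(δ+1), and this fraction lies above every rational in the lower cut.
gap-below-1 : (η : ℝ) → 1ℚ U.∈ upper η →
  ∃[ δ ] (∀ m k → (+ m ℚ./ suc k) U.∈ lower η → m * suc δ < δ * suc k)
gap-below-1 η 1∈upper with Equivalence.to (ℝ.upper-rounded η 1ℚ) 1∈upper
... | r@(mkℚ i δ _) , r<1 , r∈upper = δ , below
  where
  i≤δ : i ℤ.≤ + δ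
  i≤δ = ℤ.i<j⇒i≤pred[j] (subst₂ ℤ._<_ (ℤ.*-identityʳ i) (ℤ.*-identityˡ (+ suc δ)) (ℚ.drop-*<* r<1))
  -- If r ≤ q, then r would lie in the lower cut as well as the upper one, against disjointness.
  lower<r : ∀ q → q U.∈ lower η → q ℚ.< r
  lower<r q q∈ with ℚ.<-cmp q r
  ... | tri< q<r _ _ = q<r
  ... | tri≈ _ refl _ = contradiction (q∈ , r∈upper) (ℝ.disjoint η r)
  ... | tri> _ _ r<q = contradiction
    (Equivalence.from (ℝ.lower-rounded η r) (q , r<q , q∈) , r∈upper) (ℝ.disjoint η r)
  below : ∀ m k → (+ m ℚ./ suc k) U.∈ lower η → m * suc δ < δ * suc k
  below m k q∈ = ℤ.drop‿+<+ (begin-strict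
    + (m * suc δ)       ≡⟨ ℤ.pos-* m (suc δ) ⟩
    -- The fraction `+ m ℚ./ suc k` is stored in lowest terms; passing to unnormalised rationals
    -- recovers `m` and `suc k` for cross-multiplication.
    + m ℤ.* + suc δ     <⟨ ℚᵘ.drop-*<* (ℚᵘ.<-respˡ-≃ (ℚ.toℚᵘ-fromℚᵘ (ℚᵘ.mkℚᵘ (+ m) k))
                             (ℚ.toℚᵘ-mono-< (lower<r _ q∈))) ⟩
    i ℤ.* + suc k       ≤⟨ ℤ.*-monoʳ-≤-nonNeg (+ suc k) i≤δ ⟩
    + δ ℤ.* + suc k     ≡⟨ ℤ.pos-* δ (suc k) ⟨
    + (δ * suc k)       ∎)
    where open ℤ.≤-Reasoning

-- Comparing exponents of c gives t (k+1) < (6+t) m. Together with m/(k+1) < δ/(δ+1) this yields t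
-- (δ+1) < (6+t) δ, that is t < 6δ.
exponent-bound : ∀ {c s δ m k} t → 1 < c → c ^ t ≤ s → s ^ suc k < (c ^ (6 + t)) ^ m →
  m * suc δ < δ * suc k → 6 + t < 6 * suc δ
exponent-bound {c} {s} {δ} {m} {k} t 1<c c^t≤s s^k< m/k< =
  subst (6 + t <_) (sym (*-suc 6 δ)) (+-monoʳ-< 6 t<6δ)
  where
  open ≤-Reasoning
  tk<nm : t * suc k < (6 + t) * m
  tk<nm = ≰⇒> λ nm≤tk → <⇒≱ s^k< (begin
    (c ^ (6 + t)) ^ m   ≡⟨ ^-*-assoc c (6 + t) m ⟩
    c ^ ((6 + t) * m)   ≤⟨ ^-monoʳ-≤ c {{>-nonZero (<-trans z<s 1<c)}} nm≤tk ⟩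
    c ^ (t * suc k)     ≡⟨ ^-*-assoc c t (suc k) ⟨
    (c ^ t) ^ suc k     ≤⟨ ^-monoˡ-≤ (suc k) c^t≤s ⟩
    s ^ suc k           ∎)
  swap : ∀ t k δ → t * k * δ ≡ t * δ * k
  swap = ℕ-Solver.solve-∀
  t[1+δ]<nδ : t * suc δ < (6 + t) * δ
  t[1+δ]<nδ = *-cancelʳ-< (suc k) _ _ (begin-strict
    t * suc δ * suc k       ≡⟨ swap t (suc δ) (suc k) ⟩
    t * suc k * suc δ       <⟨ *-monoˡ-< (suc δ) tk<nm ⟩
    (6 + t) * m * suc δ     ≡⟨ *-assoc (6 + t) m (suc δ) ⟩
    (6 + t) * (m * suc δ)   ≤⟨ *-monoʳ-≤ (6 + t) (<⇒≤ m/k<) ⟩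
    (6 + t) * (δ * suc k)   ≡⟨ *-assoc (6 + t) δ (suc k) ⟨
    (6 + t) * δ * suc k     ∎)
  t<6δ : t < 6 * δ
  t<6δ = +-cancelʳ-< (t * δ) t (6 * δ)
    (subst₂ _<_ (*-suc t δ) (*-distribʳ-+ δ 6 t) t[1+δ]<nδ)

-- Primitive solutions

-- By Fermat's equation the gcd of `b` and `c` divides a power of `a`; being coprime to `a`, it is
-- 1.
coprime₃⇒coprime : ∀ {a b c} n → Coprime₃ a b c → a ^ suc n + b ^ suc n ≡ c ^ suc n → Coprime b c
coprime₃⇒coprime {a} {b} {c} n abc fermat = gcd≡1⇒coprime (coprime-^ʳ a⊥g (suc n) (∣-refl , g∣a^))
  where
  g = gcd b c
  a⊥g : Coprime g a
  a⊥g = coprime-sym (gcd≡1⇒coprime abc)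
  g∣^ : ∀ {k} → g ∣ k → g ∣ k ^ suc n
  g∣^ {k} = ∣m⇒∣m*n (k ^ n)
  g∣a^ : g ∣ a ^ suc n
  g∣a^ = ∣m+n∣m⇒∣n
    (subst (g ∣_) (trans (sym fermat) (+-comm (a ^ suc n) _)) (g∣^ (gcd[m,n]∣n b c)))
    (g∣^ (gcd[m,n]∣m b c))

coprime⇒coprime₃ : ∀ a {b c} → Coprime b c → Coprime₃ a b c
coprime⇒coprime₃ a b⊥c = trans (cong (gcd a) (coprime⇒gcd≡1 b⊥c)) (∣1⇒≡1 (gcd[m,n]∣n a 1))

powers-notOfForm : ∀ a b c {n} → 2 ≤ n → ¬ OfForm[1,N,q] (a ^ n) (b ^ n) (c ^ n)
powers-notOfForm a b c {n} 2≤n (_ , q , _ , pr , perm)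
  -- The position given is that of `q` in (1, N, q), so the prime `q` must be one of the three
  -- powers.
  with ∈-resp-↭ (↭-sym perm) (there (there (here refl)))
... | here refl                 = m^n≢prime a n 2≤n pr
... | there (here refl)         = m^n≢prime b n 2≤n pr
... | there (there (here refl)) = m^n≢prime c n 2≤n pr

-- Finiteness of the exceptions enters here: a triple whose last entry exceeds the sum is not
-- exceptional.
∈⇒≤sum : ∀ {a b c} {xs : List (ℕ × ℕ × ℕ)} → (a , b , c) ∈ xs → c ≤ sum (map (proj₂ ∘ proj₂) xs)
∈⇒≤sum (here refl)  = m≤m+n _ _
∈⇒≤sum (there c∈xs) = ≤-trans (∈⇒≤sum c∈xs) (m≤n+m _ _)

-- If c ≤ 1, then 2 ≤ a^n + b^n = c^n ≤ 1.
1<sum-of-powers : ∀ {a b c n} → 0 < a → 0 < b → a ^ n + b ^ n ≡ c ^ n → 1 < c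
1<sum-of-powers {a} {b} {c} {n} 0<a 0<b fermat = ≰⇒> λ c≤1 → <⇒≱
  (+-mono-≤ (m^n>0 a {{>-nonZero 0<a}} n) (m^n>0 b {{>-nonZero 0<b}} n))
  (begin
    a ^ n + b ^ n   ≡⟨ fermat ⟩
    c ^ n           ≤⟨ ^-monoˡ-≤ n c≤1 ⟩
    1 ^ n           ≡⟨ ^-zeroˡ n ⟩
    1               ∎)
  where open ≤-Reasoning

proposition3p11 : SmallDerivativesConjecture →
    ∃[ n₀ ] 0 < n₀ ×
    (∀ n → n₀ ≤ n → ∀ a b c → 0 < a → 0 < b → 0 < c →
    Coprime₃ a b c → a ^ n + b ^ n ≢ c ^ n)
proposition3p11 (η , _ , 1∈upper , exceptions , small) with gap-below-1 η 1∈upper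
-- The first summand contradicts `exponent-bound`; the second rules out exceptional triples.
... | δ , gap = 6 * suc δ + S , z<s , no-solution
  where
  S = sum (map (proj₂ ∘ proj₂) exceptions)

  no-solution : ∀ n → 6 * suc δ + S ≤ n → ∀ a b c → 0 < a → 0 < b → 0 < c →
    Coprime₃ a b c → a ^ n + b ^ n ≢ c ^ n
  no-solution n n₀≤n a b c 0<a 0<b 0<c abc fermat
    -- Since n ≥ 6, write n = 6 + t; the exponent n - 1 is then 5 + t, and c⁵ can be cancelled
    -- below.
    with m≤n⇒∃[o]m+o≡n (≤-trans (≤-trans (m≤m*n 6 (suc δ)) (m≤m+n (6 * suc δ) S)) n₀≤n)
  ... | t , refl =
    let ψ , (_ , additive) , independent , s , (ξ≤ , _) , m , k , m/k∈lower , s^k< =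
          small (a ^ n) (b ^ n) (c ^ n) (m^n>0 a n) (m^n>0 b n) (m^n>0 c n)
            (coprime⇒coprime₃ (a ^ n) (coprime-^ b⊥c n n)) fermat
            (powers-notOfForm a b c {n} (s≤s (s≤s z≤n)))
            -- An exceptional triple would have c^n ≤ S ≤ n, whereas n < c^n.
            (λ exceptional → <⇒≱ (n<m^n 1<c n)
              (≤-trans (∈⇒≤sum {a ^ n} {b ^ n} exceptional) (≤-trans (m≤n+m S (6 * suc δ)) n₀≤n)))
        c^t≤s = *-cancelˡ-≤ (c ^ 5) (subst (_≤ c ^ 5 * s) (^-distribˡ-+-* c 5 t)
          (c^m≤c^5*‖ψ‖ {m = 5 + t} fermat 1<c b⊥c ψ additive independent ξ≤))
    in <⇒≱ (exponent-bound {m = m} t 1<c c^t≤s s^k< (gap m k m/k∈lower))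
         (≤-trans (m≤m+n (6 * suc δ) S) n₀≤n)
    where
    instance
      _ = >-nonZero 0<a
      _ = >-nonZero 0<b
      _ = >-nonZero 0<c
      _ = m^n≢0 c 5 {{>-nonZero 0<c}}
    1<c : 1 < c
    1<c = 1<sum-of-powers {n = n} 0<a 0<b fermat
    b⊥c : Coprime b c
    b⊥c = coprime₃⇒coprime {a} (5 + t) abc fermat
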